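{- For every pair of integers $a\ge 1$ and $b\ge 2$, there are arbitrarily large graphs $G$, of order denoted $n$, such that $$\eta(G)=a,\qquad \eta_\ell(G)\ge b,\qquad\text{and}\qquad \delta(G)=n-\sqrt{\frac{2n}{2a-1}}+O(1).$$ That is, for every such $a,b$ there is a constant $C$ (depending only on $a,b$) such that for every $n_0$ there is a graph $G$ of order $n\ge n_0$ with $\eta(G)=a$, $\eta_\ell(G)\ge b$, and $\left|\delta(G)-n+\sqrt{\frac{2n}{2a-1}}\right|\le C$.
   Context: All graphs are finite and simple; $\delta(G)$ is the minimum degree of $G$, and the order of $G$ is $|V(G)|$. $\mathbb N$ denotes the positive integers and $[k]=\{1,2,\ldots,k\}$. For a graph $G$ and a labeling $\ell:V(G)\to\mathbb N$, put $S_\ell(v)=\sum_{w\in N(v)}\ell(w)$, where $N(v)$ is the open neighborhood of $v$. The labeling $\ell$ is an additive labeling if $S_\ell(u)\ne S_\ell(v)$ for every edge $uv\in E(G)$. The additive number $\eta(G)$ is the least positive integer $k$ such that $G$ has an additive labeling $\ell:V(G)\to[k]$. The list additive number $\eta_\ell(G)$ is the least positive integer $k$ such that for every assignment of $k$-element lists $L(v)\subset\mathbb N$ to the vertices $v\in V(G)$ there is an additive labeling $\ell$ of $G$ with $\ell(v)\in L(v)$ for every vertex $v$. (The subscript in $\eta_\ell(G)$ is only notation and does not refer to a particular labeling.) -}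

module Defs where

open import Level using (0ℓ)
open import Data.Nat using (ℕ; _≤_)
open import Data.Integer as ℤ using (ℤ; +_; 0ℤ)
open import Data.Fin using (Fin)
open import Data.List using (List; length; map; sum; filter; allFin)
open import Data.List.Membership.Propositional using (_∈_)
open import Data.List.Relation.Unary.All using (All)
open import Data.List.Relation.Unary.Unique.Propositional using (Unique)
open import Data.Product using (∃; ∃-syntax; _×_)
open import Data.Sum using (_⊎_)
open import Relation.Binary using (Rel; Decidable; Symmetric; Irreflexive)
open import Relation.Binary.PropositionalEquality using (_≡_; _≢_)

record Graph : Set₁ where
  field
    order    : ℕ
    _~_      : Rel (Fin order) 0ℓ
    _~?_     : Decidable _~_
    ~-sym    : Symmetric _~_
    ~-irrefl : Irreflexive _≡_ _~_

  Vertex : Set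
  Vertex = Fin order

  neighbours : Vertex → List Vertex
  neighbours v = filter (v ~?_) (allFin order)

  degree : Vertex → ℕ
  degree v = length (neighbours v)

open Graph public using (order)

IsLeast : (ℕ → Set) → ℕ → Set
IsLeast P k = P k × (∀ j → P j → k ≤ j)

-- "The least element of P is at least b".  The least element itself is not
-- asked for: extracting it from an inhabitant of P would require deciding P,
-- which for the list additive number quantifies over infinitely many list
-- assignments.  Nonemptiness is included so that the minimum is meaningful.
LeastAtLeast : (ℕ → Set) → ℕ → Set
LeastAtLeast P b = ∃ P × (∀ j → P j → b ≤ j)

module _ (G : Graph) where
  open Graph G using (Vertex; _~_; neighbours; degree)

  IsMinDegree : ℕ → Set
  IsMinDegree = IsLeast (λ d → ∃[ v ] degree v ≡ d)

  S : (Vertex → ℕ) → Vertex → ℕ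
  S ℓ v = sum (map ℓ (neighbours v))

  -- Positivity of labels is imposed where labelings are quantified over,
  -- through [k] or through the lists.
  IsAdditive : (Vertex → ℕ) → Set
  IsAdditive ℓ = ∀ {u v} → u ~ v → S ℓ u ≢ S ℓ v

  AdditivelyLabelable : ℕ → Set
  AdditivelyLabelable k =
    ∃[ ℓ ] (∀ v → 1 ≤ ℓ v × ℓ v ≤ k) × IsAdditive ℓ

  IsAdditiveNumber : ℕ → Set
  IsAdditiveNumber = IsLeast (λ k → 1 ≤ k × AdditivelyLabelable k)

  -- A k-element set of positive integers, as a duplicate-free list.
  IsLabelSet : ℕ → List ℕ → Set
  IsLabelSet k xs = length xs ≡ k × Unique xs × All (1 ≤_) xs

  AdditivelyListLabelable : ℕ → Set
  AdditivelyListLabelable k =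
    (L : Vertex → List ℕ) → (∀ v → IsLabelSet k (L v)) →
    ∃[ ℓ ] (∀ v → ℓ v ∈ L v) × IsAdditive ℓ

  ListAdditiveNumberAtLeast : ℕ → Set
  ListAdditiveNumberAtLeast =
    LeastAtLeast (λ k → 1 ≤ k × AdditivelyListLabelable k)

-- Comparisons of an integer z with the real number √(p/q), for q ≥ 1,
-- obtained by squaring and clearing the denominator.
_≤√_/_ : ℤ → ℕ → ℕ → Set
z ≤√ p / q = z ℤ.≤ 0ℤ ⊎ + q ℤ.* (z ℤ.* z) ℤ.≤ + p

√_/_≤_ : ℕ → ℕ → ℤ → Set
√ p / q ≤ z = 0ℤ ℤ.≤ z × + p ℤ.≤ + q ℤ.* (z ℤ.* z)

-- | x + √(p/q) | ≤ C, i.e. -C - x ≤ √(p/q) ≤ C - x.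
∣_+√_/_∣≤_ : ℤ → ℕ → ℕ → ℕ → Set
∣ x +√ p / q ∣≤ C =
  ((ℤ.- + C) ℤ.- x) ≤√ p / q × √ p / q ≤ (+ C ℤ.- x)

module Submission where

-- If G is the join of a graph H with independent sets ("parts"), then a vertex
-- of a part has label sum "total minus the label sum of its part".  Hence the
-- labeling is additive on the parts exactly when the part sums are distinct.
-- Let H have m vertices, take one part of each size m + 1, …, r - 1 and
-- (a - 1) r + 1 parts of size r.  Labels in [a] can give them the sums
-- m + 1, …, a r, one part for each sum.  This is n = (2 a - 1) r² / 2 + O(r)
-- vertices with δ = n - r.  As there are a r - m parts and labels in [a - 1] give
-- only sums up to (a - 1) r, fewer labels do not suffice.
--
-- H is bounded in terms of b, is additively labeled by ones, and has lists of
-- size j = b - 1 without an additive choice.  It consists of shared vertices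
-- x₀, …, x_{j-1} with lists [j] and, for each guess of their labels, a clique
-- v₀, …, v_j with v_k adjacent to x₀, …, x_{k-1}.  The list of v_k is [j] shifted
-- by the guessed sum of the labels of x₀, …, x_{k-1}.  In the clique with the
-- right guess, the sum at v_k then depends only on the position of the label of
-- v_k in its list, and j + 1 vertices share j positions.

open import Defs
open import Level using (0ℓ)
open import Data.Bool using (Bool; true; false; if_then_else_; not; _∧_; T)
open import Data.Bool.Properties using (T?; T-≡; ∧-zeroʳ)
open import Data.Nat using (ℕ; zero; suc; _+_; _*_; _∸_; _^_; _⊓_; _≤_; _<_; _<ᵇ_; z≤n; s≤s)
open import Data.Nat.ListAction using (sum)
open import Data.Nat.Properties
open import Data.Nat.Tactic.RingSolver using (solve-∀)
open import Data.Fin as Fin using (Fin; zero; suc; toℕ; fromℕ<; _↑ˡ_; _↑ʳ_; splitAt; finToFun; funToFin)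
open import Data.Fin.Properties as Fin using (toℕ<n; toℕ-fromℕ<; toℕ-injective; splitAt-↑ˡ; splitAt-↑ʳ; splitAt⁻¹-↑ˡ; splitAt⁻¹-↑ʳ; finToFun-funToFin; pigeonhole)
open import Data.List using (List; []; _∷_; length; map; filter; allFin; tabulate; lookup; take; applyUpTo; _++_; cartesianProductWith)
open import Data.List.Properties using (map-tabulate; tabulate-cong; length-map; length-++; length-take; length-applyUpTo; take++drop≡id)
open import Data.List.Membership.Propositional using (_∈_; _∉_; find; lose)
open import Data.List.Membership.Propositional.Properties using (∈-lookup; ∈-++⁺ˡ; ∈-++⁺ʳ; ∈-map⁺; ∈-cartesianProductWith⁺; ∈-applyUpTo⁻)
open import Data.List.Membership.DecPropositional _≟_ using (_∈?_)
open import Data.List.Relation.Unary.Any using (here; any?; index)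
open import Data.List.Relation.Unary.Any.Properties using (lookup-index)
import Data.List.Relation.Unary.All as All
import Data.List.Relation.Unary.All.Properties as All
open import Data.List.Relation.Unary.AllPairs using (_∷_)
open import Data.List.Relation.Unary.Unique.Propositional using (Unique)
import Data.List.Relation.Unary.Unique.Propositional.Properties as Unique
open import Data.Product using (Σ; Σ-syntax; ∃-syntax; ∃₂; _×_; _,_; proj₁; proj₂)
open import Data.Sum using (inj₁; inj₂; [_,_]′; map₁)
open import Function using (_∘_; const; id)
open import Function.Bundles using (mk⇔; Equivalence)
open import Relation.Nullary using (does; yes; no; ¬_; ¬?; contradiction)
open import Relation.Nullary.Decidable using (decidable-stable; dec-true; dec-false; does-⇔)
open import Relation.Unary using (Pred; Decidable)
open import Relation.Binary.PropositionalEquality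

-- Finite sums

infixr 7 _⊙_
_⊙_ : Bool → ℕ → ℕ
b ⊙ x = if b then x else 0

∑ : ∀ {n} → (Fin n → ℕ) → ℕ
∑ f = sum (tabulate f)

∑-cong : ∀ {n} {f g : Fin n → ℕ} → f ≗ g → ∑ f ≡ ∑ g
∑-cong = cong sum ∘ tabulate-cong

∑-mono : ∀ {n} {f g : Fin n → ℕ} → (∀ i → f i ≤ g i) → ∑ f ≤ ∑ g
∑-mono {zero}  f≤g = z≤n
∑-mono {suc n} f≤g = +-mono-≤ (f≤g zero) (∑-mono (f≤g ∘ suc))

∑-const : ∀ n c → ∑ {n} (const c) ≡ n * c
∑-const zero    c = refl
∑-const (suc n) c = cong (c +_) (∑-const n c)

∑-zero : ∀ n → ∑ {n} (const 0) ≡ 0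
∑-zero n = trans (∑-const n 0) (*-zeroʳ n)

∑-one : ∀ n → ∑ {n} (const 1) ≡ n
∑-one n = trans (∑-const n 1) (*-identityʳ n)

term≤∑ : ∀ {n} (f : Fin n → ℕ) i → f i ≤ ∑ f
term≤∑ f zero    = m≤m+n _ _
term≤∑ f (suc i) = ≤-trans (term≤∑ (f ∘ suc) i) (m≤n+m _ _)

-- Both sums lose the same amount when their `k`-th terms are removed. Moving these terms across the
-- equation avoids truncated subtraction; deleting a term and isolating a term are both instances.
∑-exchange : ∀ {n} (f g : Fin n → ℕ) k → (∀ i → k ≢ i → f i ≡ g i) →
             ∑ f + g k ≡ ∑ g + f k
∑-exchange {suc n} f g zero eq = begin
  f zero + ∑ (f ∘ suc) + g zero ≡⟨ +-comm _ (g zero) ⟩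
  g zero + (f zero + ∑ (f ∘ suc)) ≡⟨ cong (g zero +_) (+-comm (f zero) _) ⟩
  g zero + (∑ (f ∘ suc) + f zero)
    ≡⟨ cong (λ s → g zero + (s + f zero)) (∑-cong λ i → eq (suc i) λ ()) ⟩
  g zero + (∑ (g ∘ suc) + f zero) ≡⟨ +-assoc (g zero) _ _ ⟨
  ∑ g + f zero ∎
  where open ≡-Reasoning
∑-exchange {suc n} f g (suc k) eq = begin
  f zero + ∑ (f ∘ suc) + g (suc k)   ≡⟨ +-assoc (f zero) _ _ ⟩
  f zero + (∑ (f ∘ suc) + g (suc k))
    ≡⟨ cong₂ _+_ (eq zero λ ()) (∑-exchange _ _ k λ i k≢i → eq (suc i) (k≢i ∘ Fin.suc-injective)) ⟩
  g zero + (∑ (g ∘ suc) + f (suc k)) ≡⟨ +-assoc (g zero) _ _ ⟨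
  ∑ g + f (suc k) ∎
  where open ≡-Reasoning

∑-others : ∀ {n} (f : Fin n → ℕ) k →
           ∑ (λ i → not (does (k Fin.≟ i)) ⊙ f i) + f k ≡ ∑ f
∑-others f k = begin
  ∑ g + f k ≡⟨ ∑-exchange g f k (λ i k≢i → cong (λ b → not b ⊙ f i) (dec-false (k Fin.≟ i) k≢i)) ⟩
  ∑ f + g k ≡⟨ cong (λ b → ∑ f + not b ⊙ f k) (dec-true (k Fin.≟ k) refl) ⟩
  ∑ f + 0   ≡⟨ +-identityʳ _ ⟩
  ∑ f       ∎
  where
  open ≡-Reasoning
  g : _ → ℕ
  g i = not (does (k Fin.≟ i)) ⊙ f i

∑-only : ∀ {n} (f : Fin n → ℕ) k → (∀ i → k ≢ i → f i ≡ 0) → ∑ f ≡ f k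
∑-only {n} f k eq = begin
  ∑ f              ≡⟨ +-identityʳ _ ⟨
  ∑ f + 0          ≡⟨ ∑-exchange f (const 0) k eq ⟩
  ∑ {n} (const 0) + f k ≡⟨ cong (_+ f k) (∑-zero n) ⟩
  f k              ∎
  where open ≡-Reasoning

∑-splitAt : ∀ m {n} (f : Fin m → ℕ) (g : Fin n → ℕ) →
            ∑ ([ f , g ]′ ∘ splitAt m) ≡ ∑ f + ∑ g
∑-splitAt zero    f g = refl
∑-splitAt (suc m) f g = begin
  f zero + ∑ ([ f , g ]′ ∘ splitAt (suc m) ∘ suc)
    ≡⟨ cong (f zero +_) (∑-cong λ i → step (splitAt m i)) ⟩
  f zero + ∑ ([ f ∘ suc , g ]′ ∘ splitAt m)
    ≡⟨ cong (f zero +_) (∑-splitAt m (f ∘ suc) g) ⟩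
  f zero + (∑ (f ∘ suc) + ∑ g)
    ≡⟨ +-assoc (f zero) _ _ ⟨
  ∑ f + ∑ g ∎
  where
  open ≡-Reasoning
  step : ∀ s → [ f , g ]′ (map₁ suc s) ≡ [ f ∘ suc , g ]′ s
  step (inj₁ _) = refl
  step (inj₂ _) = refl

sum-filter : ∀ {A : Set} {P : Pred A 0ℓ} (P? : Decidable P) (f : A → ℕ) xs →
             sum (map f (filter P? xs)) ≡ sum (map (λ x → does (P? x) ⊙ f x) xs)
sum-filter P? f [] = refl
sum-filter P? f (x ∷ xs) with does (P? x)
... | true  = cong (f x +_) (sum-filter P? f xs)
... | false = sum-filter P? f xs

length-as-sum : ∀ {A : Set} (xs : List A) → length xs ≡ sum (map (const 1) xs)
length-as-sum []       = refl
length-as-sum (x ∷ xs) = cong suc (length-as-sum xs)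

-- Label sums and degrees as weighted finite sums

module _ (G : Graph) where
  open Graph G using (_~?_; degree)

  S-∑ : ∀ ℓ v → S G ℓ v ≡ ∑ (λ w → does (v ~? w) ⊙ ℓ w)
  S-∑ ℓ v = trans (sum-filter (v ~?_) ℓ (allFin _)) (cong sum (map-tabulate id (λ w → does (v ~? w) ⊙ ℓ w)))

  degree-S : ∀ v → degree v ≡ S G (const 1) v
  degree-S v = length-as-sum (Graph.neighbours G v)

-- Finiteness of the list additive number

lookup-≢ : ∀ {A : Set} {xs : List A} → Unique xs → ∀ {i j} → i Fin.< j → lookup xs i ≢ lookup xs j
lookup-≢ (x≢ ∷ _)     {zero}  {suc j} _         = All.lookup x≢ (∈-lookup j)
lookup-≢ (_ ∷ unique) {suc i} {suc j} (s≤s i<j) = lookup-≢ unique i<j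

-- Otherwise each position of `xs` has a position in `ys` with the same entry. By the pigeonhole
-- principle two positions of `xs` share one in `ys`, which repeats an entry of `xs`.
unique⇒fresh : ∀ {xs} → Unique xs → ∀ ys → length ys < length xs →
               ∃[ x ] x ∈ xs × x ∉ ys
unique⇒fresh {xs} unique ys ys<xs with any? (λ x → ¬? (x ∈? ys)) xs
... | yes some = find some
... | no  none =
  let i , j , i<j , eq = pigeonhole ys<xs (index ∘ hit)
      xᵢ≡xⱼ = trans (lookup-index (hit i)) (trans (cong (lookup ys) eq) (sym (lookup-index (hit j))))
  in contradiction xᵢ≡xⱼ (lookup-≢ unique i<j)
  where
  hit : ∀ i → lookup xs i ∈ ys
  hit i = decidable-stable (lookup xs i ∈? ys) λ ∉ → none (lose (∈-lookup i) ∉)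

subsetSums : ∀ {n} → (Fin n → ℕ) → List ℕ
subsetSums {zero}  ℓ = 0 ∷ []
subsetSums {suc n} ℓ = subsetSums (ℓ ∘ suc) ++ map (ℓ zero +_) (subsetSums (ℓ ∘ suc))

length-subsetSums : ∀ {n} (ℓ : Fin n → ℕ) → length (subsetSums ℓ) ≡ 2 ^ n
length-subsetSums {zero}  ℓ = refl
length-subsetSums {suc n} ℓ
  rewrite length-++ (subsetSums (ℓ ∘ suc)) {map (ℓ zero +_) (subsetSums (ℓ ∘ suc))}
        | length-map (ℓ zero +_) (subsetSums (ℓ ∘ suc))
        | length-subsetSums (ℓ ∘ suc)
        | +-identityʳ (2 ^ n) = refl

∈-subsetSums : ∀ {n} (ℓ : Fin n → ℕ) (A : Fin n → Bool) → ∑ (λ i → A i ⊙ ℓ i) ∈ subsetSums ℓ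
∈-subsetSums {zero}  ℓ A = here refl
∈-subsetSums {suc n} ℓ A with A zero
... | false = ∈-++⁺ˡ (∈-subsetSums (ℓ ∘ suc) (A ∘ suc))
... | true  = ∈-++⁺ʳ _ (∈-map⁺ (ℓ zero +_) (∈-subsetSums (ℓ ∘ suc) (A ∘ suc)))

length-cartesianProductWith : ∀ {A B C : Set} (f : A → B → C) xs ys →
  length (cartesianProductWith f xs ys) ≡ length xs * length ys
length-cartesianProductWith f []       ys = refl
length-cartesianProductWith f (x ∷ xs) ys = trans (length-++ (map (f x) ys))
  (cong₂ _+_ (length-map (f x) ys) (length-cartesianProductWith f xs ys))

-- Chosen greedily, the labels have pairwise distinct subset sums: the next one
-- only has to avoid the differences of subset sums of the others.
distinctSubsetSums : ∀ {n} (L : Fin n → List ℕ) →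
  (∀ i → Unique (L i)) → (∀ i → 2 ^ n * 2 ^ n < length (L i)) →
  Σ[ ℓ ∈ (Fin n → ℕ) ] (∀ i → ℓ i ∈ L i) ×
    (∀ (A B : Fin n → Bool) → ∑ (λ i → A i ⊙ ℓ i) ≡ ∑ (λ i → B i ⊙ ℓ i) → A ≗ B)
distinctSubsetSums {zero}  L unique long = (λ ()) , (λ ()) , λ _ _ _ ()
distinctSubsetSums {suc n} L unique long = extend
  (distinctSubsetSums (L ∘ suc) (unique ∘ suc) λ i → ≤-<-trans 4ⁿ≤4ⁿ⁺¹ (long (suc i)))
  where
  4ⁿ≤4ⁿ⁺¹ : 2 ^ n * 2 ^ n ≤ 2 ^ suc n * 2 ^ suc n
  4ⁿ≤4ⁿ⁺¹ = *-mono-≤ (m≤m+n (2 ^ n) _) (m≤m+n (2 ^ n) _)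

  extend : Σ[ ℓ ∈ (Fin n → ℕ) ] (∀ i → ℓ i ∈ L (suc i)) ×
             (∀ A B → ∑ (λ i → A i ⊙ ℓ i) ≡ ∑ (λ i → B i ⊙ ℓ i) → A ≗ B) →
           Σ[ ℓ ∈ (Fin (suc n) → ℕ) ] (∀ i → ℓ i ∈ L i) ×
             (∀ A B → ∑ (λ i → A i ⊙ ℓ i) ≡ ∑ (λ i → B i ⊙ ℓ i) → A ≗ B)
  extend (ℓ , ℓ∈L , distinct) = ℓ⁺ , ℓ⁺∈L , distinct⁺
    where
    -- Truncation is harmless: `x` plus one subset sum can equal another only if `x` is their true
    -- difference.
    differences : List ℕ
    differences = cartesianProductWith _∸_ (subsetSums ℓ) (subsetSums ℓ)

    length-differences : length differences ≡ 2 ^ n * 2 ^ n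
    length-differences = trans (length-cartesianProductWith _∸_ (subsetSums ℓ) (subsetSums ℓ))
      (cong₂ _*_ (length-subsetSums ℓ) (length-subsetSums ℓ))

    fresh : ∃[ x ] x ∈ L zero × x ∉ differences
    fresh = unique⇒fresh (unique zero) differences
      (≤-<-trans (≤-trans (≤-reflexive length-differences) 4ⁿ≤4ⁿ⁺¹) (long zero))

    x : ℕ
    x = proj₁ fresh

    ℓ⁺ : Fin (suc n) → ℕ
    ℓ⁺ zero    = x
    ℓ⁺ (suc i) = ℓ i

    ℓ⁺∈L : ∀ i → ℓ⁺ i ∈ L i
    ℓ⁺∈L zero    = proj₁ (proj₂ fresh)
    ℓ⁺∈L (suc i) = ℓ∈L i

    x-fresh : (A B : Fin n → Bool) → x + ∑ (λ i → A i ⊙ ℓ i) ≢ ∑ (λ i → B i ⊙ ℓ i)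
    x-fresh A B eq = proj₂ (proj₂ fresh) (subst (_∈ differences)
      (trans (cong (_∸ ∑ (λ i → A i ⊙ ℓ i)) (sym eq)) (m+n∸n≡m x (∑ λ i → A i ⊙ ℓ i)))
      (∈-cartesianProductWith⁺ _∸_ (∈-subsetSums ℓ B) (∈-subsetSums ℓ A)))

    distinct⁺ : ∀ (A B : Fin (suc n) → Bool) →
                ∑ (λ i → A i ⊙ ℓ⁺ i) ≡ ∑ (λ i → B i ⊙ ℓ⁺ i) → A ≗ B
    -- If `A` and `B` disagree at `zero`, then `x` would be a difference of old subset sums; if they
    -- agree there, `x` cancels or is absent.
    distinct⁺ A B eq i with A zero in A₀ | B zero in B₀
    distinct⁺ A B eq _       | true  | false = contradiction eq (x-fresh (A ∘ suc) (B ∘ suc))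
    distinct⁺ A B eq _       | false | true  = contradiction (sym eq) (x-fresh (B ∘ suc) (A ∘ suc))
    distinct⁺ A B eq zero    | false | false = trans A₀ (sym B₀)
    distinct⁺ A B eq zero    | true  | true  = trans A₀ (sym B₀)
    distinct⁺ A B eq (suc i) | false | false = distinct (A ∘ suc) (B ∘ suc) eq i
    distinct⁺ A B eq (suc i) | true  | true  = distinct (A ∘ suc) (B ∘ suc) (+-cancelˡ-≡ x _ _ eq) i

-- Labels with distinct subset sums give equal sums only to vertices with equal neighbourhoods. Ends
-- of an edge `u ~ v` have different ones: `u` lies in that of `v` but not in its own.
additivelyListLabelable : ∀ G → ∃[ k ] 1 ≤ k × AdditivelyListLabelable G k
additivelyListLabelable G = suc (2 ^ order G * 2 ^ order G) , s≤s z≤n , label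
  where
  open Graph G using (_~?_; ~-irrefl; ~-sym)
  label : AdditivelyListLabelable G (suc (2 ^ order G * 2 ^ order G))
  label L L-ok
    with ℓ , ℓ∈L , distinct ← distinctSubsetSums L (proj₁ ∘ proj₂ ∘ L-ok)
                                (λ v → ≤-reflexive (sym (proj₁ (L-ok v))))
    = ℓ , ℓ∈L , λ {u} {v} u~v eq → contradiction
        (begin
          true              ≡⟨ dec-true (v ~? u) (~-sym u~v) ⟨
          does (v ~? u)     ≡⟨ distinct (does ∘ (u ~?_)) (does ∘ (v ~?_))
                                 (trans (sym (S-∑ G ℓ u)) (trans eq (S-∑ G ℓ v))) u ⟨
          does (u ~? u)     ≡⟨ dec-false (u ~? u) (~-irrefl refl) ⟩
          false             ∎)
        λ ()
    where open ≡-Reasoning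

-- Vertex sets partitioned into blocks

-- A vertex as a block together with a position in it, so that adjacency can be defined by cases on
-- blocks. `decode` and `encode` translate from and to the numbering that `Graph` demands.
Cell : ∀ {K} → (Fin K → ℕ) → Set
Cell size = Σ _ (Fin ∘ size)

shift : ∀ {K} {size : Fin (suc K) → ℕ} → Cell (size ∘ suc) → Cell size
shift (t , i) = suc t , i

decode : ∀ {K} (size : Fin K → ℕ) → Fin (∑ size) → Cell size
decode {suc K} size = [ zero ,_ , shift ∘ decode (size ∘ suc) ]′ ∘ splitAt (size zero)

encode : ∀ {K} (size : Fin K → ℕ) → Cell size → Fin (∑ size)
encode size (zero  , i) = i ↑ˡ _
encode size (suc t , i) = size zero ↑ʳ encode (size ∘ suc) (t , i)

decode-encode : ∀ {K} (size : Fin K → ℕ) c → decode size (encode size c) ≡ c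
decode-encode size (zero  , i)
  rewrite splitAt-↑ˡ (size zero) i (∑ (size ∘ suc)) = refl
decode-encode size (suc t , i)
  rewrite splitAt-↑ʳ (size zero) _ (encode (size ∘ suc) (t , i)) = cong shift (decode-encode (size ∘ suc) (t , i))

encode-decode : ∀ {K} (size : Fin K → ℕ) v → encode size (decode size v) ≡ v
encode-decode {suc K} size v with splitAt (size zero) v in eq
... | inj₁ i = splitAt⁻¹-↑ˡ eq
... | inj₂ w = trans (cong (size zero ↑ʳ_) (encode-decode (size ∘ suc) w)) (splitAt⁻¹-↑ʳ eq)

∑-decode : ∀ {K} (size : Fin K → ℕ) (f : Cell size → ℕ) →
           ∑ (f ∘ decode size) ≡ ∑ λ t → ∑ λ i → f (t , i)
∑-decode {zero}  size f = refl
∑-decode {suc K} size f = begin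
  ∑ (f ∘ decode size)
    ≡⟨ ∑-cong (λ v → split (splitAt (size zero) v)) ⟩
  ∑ ([ f ∘ (zero ,_) , f ∘ shift ∘ decode (size ∘ suc) ]′ ∘ splitAt (size zero))
    ≡⟨ ∑-splitAt (size zero) _ _ ⟩
  ∑ (f ∘ (zero ,_)) + ∑ (f ∘ shift ∘ decode (size ∘ suc))
    ≡⟨ cong (∑ (f ∘ (zero ,_)) +_) (∑-decode (size ∘ suc) (f ∘ shift)) ⟩
  ∑ (λ t → ∑ λ i → f (t , i)) ∎
  where
  open ≡-Reasoning
  split : ∀ s → f ([ zero ,_ , shift ∘ decode (size ∘ suc) ]′ s) ≡
                [ f ∘ (zero ,_) , f ∘ shift ∘ decode (size ∘ suc) ]′ s
  split (inj₁ _) = refl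
  split (inj₂ _) = refl

module BlockGraph {K} (size : Fin K → ℕ) (adj : Cell size → Cell size → Bool)
                  (adj-sym : ∀ c d → adj c d ≡ adj d c) (adj-irrefl : ∀ c → adj c c ≡ false) where

  graph : Graph
  graph = record
    { order    = ∑ size
    ; _~_      = λ v w → T (adj (decode size v) (decode size w))
    ; _~?_     = λ v w → T? (adj (decode size v) (decode size w))
    ; ~-sym    = λ {v} {w} → subst T (adj-sym (decode size v) (decode size w))
    ; ~-irrefl = λ { {v} refl v~v → subst T (adj-irrefl (decode size v)) v~v }
    }

  adj⇒~ : ∀ {c d} → adj c d ≡ true → Graph._~_ graph (encode size c) (encode size d)
  adj⇒~ {c} {d} c~d = subst T (sym (trans (cong₂ adj (decode-encode size c) (decode-encode size d)) c~d)) _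

  S-cell : (Cell size → ℕ) → Cell size → ℕ
  S-cell f c = ∑ λ t → ∑ λ i → adj c (t , i) ⊙ f (t , i)

  S-graph : ∀ ℓ c → S graph ℓ (encode size c) ≡ S-cell (ℓ ∘ encode size) c
  S-graph ℓ c = begin
    S graph ℓ (encode size c)
      ≡⟨ S-∑ graph ℓ (encode size c) ⟩
    ∑ (λ w → adj (decode size (encode size c)) (decode size w) ⊙ ℓ w)
      ≡⟨ ∑-cong (λ w → cong₂ (λ d → adj d (decode size w) ⊙_)
                         (decode-encode size c) (cong ℓ (sym (encode-decode size w)))) ⟩
    ∑ (λ w → adj c (decode size w) ⊙ ℓ (encode size (decode size w)))
      ≡⟨ ∑-decode size (λ d → adj c d ⊙ ℓ (encode size d)) ⟩
    S-cell (ℓ ∘ encode size) c ∎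
    where open ≡-Reasoning

  S-cell-cong : ∀ {f g} → f ≗ g → ∀ c → S-cell f c ≡ S-cell g c
  S-cell-cong f≗g c = ∑-cong λ t → ∑-cong λ i → cong (adj c (t , i) ⊙_) (f≗g (t , i))

  S-decode : ∀ f v → S graph (f ∘ decode size) v ≡ S-cell f (decode size v)
  S-decode f v = begin
    S graph (f ∘ decode size) v
      ≡⟨ cong (S graph (f ∘ decode size)) (encode-decode size v) ⟨
    S graph (f ∘ decode size) (encode size (decode size v))
      ≡⟨ S-graph (f ∘ decode size) (decode size v) ⟩
    S-cell (f ∘ decode size ∘ encode size) (decode size v)
      ≡⟨ S-cell-cong (λ c → cong f (decode-encode size c)) (decode size v) ⟩
    S-cell f (decode size v) ∎
    where open ≡-Reasoning

-- The graph H

-- What the clique vertex v_k receives from the shared vertices x₀, ..., x_{k-1}.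
prefix : ∀ {n} → (Fin n → ℕ) → ℕ → ℕ
prefix x k = ∑ λ i → (toℕ i <ᵇ k) ⊙ x i

prefix-cong : ∀ {n} {x y : Fin n → ℕ} → x ≗ y → ∀ k → prefix x k ≡ prefix y k
prefix-cong x≗y k = ∑-cong λ i → cong ((toℕ i <ᵇ k) ⊙_) (x≗y i)

prefix-ones : ∀ {n k} → k ≤ n → prefix {n} (const 1) k ≡ k
prefix-ones {n} z≤n       = ∑-zero n
prefix-ones     (s≤s k≤n) = cong suc (prefix-ones k≤n)

interval : ℕ → ℕ → List ℕ
interval p j = applyUpTo (λ c → p + suc c) j

interval-labelSet : ∀ {G} p j → IsLabelSet G j (interval p j)
interval-labelSet p j =
  length-applyUpTo _ j ,
  Unique.applyUpTo⁺₁ _ j (λ i<i′ _ eq → <⇒≢ i<i′ (suc-injective (+-cancelˡ-≡ p _ _ eq))) ,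
  All.applyUpTo⁺₂ _ j (λ c → ≤-trans (s≤s z≤n) (m≤n+m (suc c) p))

∈-interval : ∀ {x} p j → x ∈ interval p j → ∃[ c ] c < j × x ≡ p + suc c
∈-interval p j = ∈-applyUpTo⁻ (λ c → p + suc c)

-- Failure of a choice is stated as an edge with equal sums: such an edge survives in the join,
-- where both sums grow by the same amount.
Separator : ℕ → Set₁
Separator j = Σ[ H ∈ Graph ] IsAdditive H (const 1) ×
  Σ[ L ∈ (Graph.Vertex H → List ℕ) ] (∀ v → IsLabelSet H j (L v)) ×
    (∀ ℓ → (∀ v → ℓ v ∈ L v) → ∃₂ λ u v → Graph._~_ H u v × S H ℓ u ≡ S H ℓ v)

-- Block zero consists of the shared vertices, block suc g is the clique of the
-- guess g.  Labels up to j are guessed in the larger range M so that there are more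
-- than 2 j guesses: the degrees of the shared vertices then exceed all others.
module Gadget (j′ : ℕ) where

  j M N : ℕ
  j = suc j′
  M = suc (j + j)
  N = M ^ j

  size : Fin (suc N) → ℕ
  size zero    = j
  size (suc g) = suc j

  adj : Cell size → Cell size → Bool
  adj (zero  , i) (zero   , i′) = false
  adj (zero  , i) (suc g  , k)  = toℕ i <ᵇ toℕ k
  adj (suc g , k) (zero   , i)  = toℕ i <ᵇ toℕ k
  adj (suc g , k) (suc g′ , k′) = does (g Fin.≟ g′) ∧ not (does (k Fin.≟ k′))

  adj-sym : ∀ c d → adj c d ≡ adj d c
  adj-sym (zero  , i) (zero   , i′) = refl
  adj-sym (zero  , i) (suc g  , k)  = refl
  adj-sym (suc g , k) (zero   , i)  = refl
  adj-sym (suc g , k) (suc g′ , k′) = cong₂ (λ a b → a ∧ not b)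
    (does-⇔ (mk⇔ sym sym) (g Fin.≟ g′) (g′ Fin.≟ g)) (does-⇔ (mk⇔ sym sym) (k Fin.≟ k′) (k′ Fin.≟ k))

  adj-irrefl : ∀ c → adj c c ≡ false
  adj-irrefl (zero  , i) = refl
  adj-irrefl (suc g , k) = trans (cong (λ b → _ ∧ not b) (dec-true (k Fin.≟ k) refl)) (∧-zeroʳ _)

  open BlockGraph size adj adj-sym adj-irrefl public

  -- Together with its own label, a clique vertex collects the total of its clique, which is the
  -- same for all `k`. Other cliques contribute nothing.
  S-clique : ∀ f g k → S-cell f (suc g , k) + f (suc g , k) ≡
             prefix (λ i → f (zero , i)) (toℕ k) + ∑ (λ k′ → f (suc g , k′))
  S-clique f g k = begin
    P + ∑ (λ g′ → ∑ λ k′ → adj (suc g , k) (suc g′ , k′) ⊙ f (suc g′ , k′)) + f (suc g , k)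
      ≡⟨ cong (λ s → P + s + f (suc g , k)) (trans (∑-only _ g others) own) ⟩
    P + ∑ (λ k′ → not (does (k Fin.≟ k′)) ⊙ f (suc g , k′)) + f (suc g , k)
      ≡⟨ +-assoc P _ _ ⟩
    P + (∑ (λ k′ → not (does (k Fin.≟ k′)) ⊙ f (suc g , k′)) + f (suc g , k))
      ≡⟨ cong (P +_) (∑-others (λ k′ → f (suc g , k′)) k) ⟩
    P + ∑ (λ k′ → f (suc g , k′)) ∎
    where
    open ≡-Reasoning
    P : ℕ
    P = prefix (λ i → f (zero , i)) (toℕ k)

    others : ∀ g′ → g ≢ g′ → ∑ (λ k′ → adj (suc g , k) (suc g′ , k′) ⊙ f (suc g′ , k′)) ≡ 0
    others g′ g≢g′ = trans
      (∑-cong λ k′ → cong (λ b → (b ∧ not (does (k Fin.≟ k′))) ⊙ f (suc g′ , k′)) (dec-false (g Fin.≟ g′) g≢g′))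
      (∑-zero (suc j))

    own : ∑ (λ k′ → adj (suc g , k) (suc g , k′) ⊙ f (suc g , k′)) ≡
          ∑ (λ k′ → not (does (k Fin.≟ k′)) ⊙ f (suc g , k′))
    own = ∑-cong λ k′ → cong (λ b → (b ∧ not (does (k Fin.≟ k′))) ⊙ f (suc g , k′)) (dec-true (g Fin.≟ g) refl)

  -- Thus v_k has degree k + j, which tells the vertices of one clique apart.
  S-clique-ones : ∀ g k → S-cell (const 1) (suc g , k) + 1 ≡ toℕ k + suc j
  S-clique-ones g k = trans (S-clique (const 1) g k)
    (cong₂ _+_ (prefix-ones (≤-pred (toℕ<n k))) (∑-one (suc j)))

  S-clique<M : ∀ g k → S-cell (const 1) (suc g , k) < M
  S-clique<M g k = begin
    suc (S-cell (const 1) (suc g , k)) ≡⟨ +-comm 1 _ ⟩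
    S-cell (const 1) (suc g , k) + 1   ≡⟨ S-clique-ones g k ⟩
    toℕ k + suc j                      ≤⟨ +-monoˡ-≤ (suc j) (≤-pred (toℕ<n k)) ⟩
    j + suc j                          ≡⟨ +-suc j j ⟩
    M                                  ∎
    where open ≤-Reasoning

  -- Adjacency to x_i depends on the position in the clique and not on the guess. One neighbour in
  -- one clique therefore yields one in each of the `N = M ^ j ≥ M` cliques.
  M≤S-shared : ∀ i g k → T (adj (zero , i) (suc g , k)) → M ≤ S-cell (const 1) (zero , i)
  M≤S-shared i g k i<k = begin
    M                             ≤⟨ m≤m*n M (M ^ j′) {{m^n≢0 M j′}} ⟩
    N                             ≡⟨ ∑-one N ⟨
    ∑ {N} (const 1)               ≤⟨ ∑-mono {N} (λ _ → 1≤hits k i<k) ⟩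
    ∑ {N} (const hits)            ≤⟨ m≤n+m _ _ ⟩
    S-cell (const 1) (zero , i)   ∎
    where
    open ≤-Reasoning
    hits : ℕ
    hits = ∑ λ (k′ : Fin (suc j)) → (toℕ i <ᵇ toℕ k′) ⊙ 1

    1≤hits : ∀ k → T (toℕ i <ᵇ toℕ k) → 1 ≤ hits
    1≤hits k i<k with toℕ i <ᵇ toℕ k | term≤∑ (λ (k′ : Fin (suc j)) → (toℕ i <ᵇ toℕ k′) ⊙ 1) k
    ... | true | 1≤∑ = 1≤∑

  S-ones-distinct : ∀ c d → T (adj c d) → S-cell (const 1) c ≢ S-cell (const 1) d
  S-ones-distinct (zero  , i) (suc g  , k)  i<k eq =
    <⇒≢ (<-≤-trans (S-clique<M g k) (M≤S-shared i g k i<k)) (sym eq)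
  S-ones-distinct (suc g , k) (zero   , i)  i<k eq =
    <⇒≢ (<-≤-trans (S-clique<M g k) (M≤S-shared i g k i<k)) eq
  S-ones-distinct (suc g , k) (suc g′ , k′) c~d eq
    with refl ← toℕ-injective (+-cancelʳ-≡ (suc j) (toℕ k) (toℕ k′)
                  (trans (sym (S-clique-ones g k)) (trans (cong (_+ 1) eq) (S-clique-ones g′ k′))))
    = subst T (trans (cong (λ b → does (g Fin.≟ g′) ∧ not b) (dec-true (k Fin.≟ k) refl)) (∧-zeroʳ _)) c~d

  ones-additive : IsAdditive graph (const 1)
  ones-additive {u} {v} u~v eq = S-ones-distinct (decode size u) (decode size v) u~v
    (trans (sym (S-decode (const 1) u)) (trans eq (S-decode (const 1) v)))

  -- The shift of the list of a cell. A guess `g : Fin (M ^ j)` encodes a function from the shared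
  -- vertices to `Fin M`.
  base : Cell size → ℕ
  base (zero  , i) = 0
  base (suc g , k) = prefix (toℕ ∘ finToFun {M} {j} g) (toℕ k)

  lists : Graph.Vertex graph → List ℕ
  lists v = interval (base (decode size v)) j

  lists-bad : ∀ ℓ → (∀ v → ℓ v ∈ lists v) →
              ∃₂ λ u v → Graph._~_ graph u v × S graph ℓ u ≡ S graph ℓ v
  lists-bad ℓ ℓ∈ =
    let k , k′ , k<k′ , eq = pigeonhole (n<1+n j) (λ k → fromℕ< (c<j k))
        c≡c′ = trans (sym (toℕ-fromℕ< (c<j k))) (trans (cong toℕ eq) (toℕ-fromℕ< (c<j k′)))
    in encode size (suc g , k) , encode size (suc g , k′) ,
       adj⇒~ {suc g , k} {suc g , k′}
         (cong₂ (λ a b → a ∧ not b) (dec-true (g Fin.≟ g) refl) (dec-false (k Fin.≟ k′) (Fin.<⇒≢ k<k′))) ,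
       (begin
         S graph ℓ (encode size (suc g , k))   ≡⟨ S-graph ℓ (suc g , k) ⟩
         S-cell f (suc g , k)                  ≡⟨ +-cancelʳ-≡ (suc (c k)) _ _
           (trans (S+c k) (sym (trans (cong (λ x → S-cell f (suc g , k′) + suc x) c≡c′) (S+c k′)))) ⟩
         S-cell f (suc g , k′)                 ≡⟨ S-graph ℓ (suc g , k′) ⟨
         S graph ℓ (encode size (suc g , k′))  ∎)
    where
    open ≡-Reasoning
    f : Cell size → ℕ
    f = ℓ ∘ encode size

    f∈ : ∀ c → f c ∈ interval (base c) j
    f∈ c = subst (λ d → f c ∈ interval (base d) j) (decode-encode size c) (ℓ∈ (encode size c))

    x<M : ∀ i → f (zero , i) < M
    x<M i with c , c<j , eq ← ∈-interval 0 j (f∈ (zero , i)) =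
      s≤s (≤-trans (≤-reflexive eq) (≤-trans c<j (m≤m+n j j)))

    g : Fin N
    g = funToFin (λ i → fromℕ< (x<M i))

    g-guesses : ∀ i → toℕ (finToFun {M} {j} g i) ≡ f (zero , i)
    g-guesses i = trans (cong toℕ (finToFun-funToFin (λ i → fromℕ< (x<M i)) i)) (toℕ-fromℕ< (x<M i))

    chosen : ∀ k → ∃[ c ] c < j × f (suc g , k) ≡ base (suc g , k) + suc c
    chosen k = ∈-interval (base (suc g , k)) j (f∈ (suc g , k))

    c : Fin (suc j) → ℕ
    c = proj₁ ∘ chosen

    c<j : ∀ k → c k < j
    c<j = proj₁ ∘ proj₂ ∘ chosen

    -- Since the guess is right, the shift `P` of the list equals what v_k receives from the shared
    -- vertices. Both cancel in `S-clique`, and the right side no longer depends on `k`.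
    S+c : ∀ k → S-cell f (suc g , k) + suc (c k) ≡ ∑ (λ k′ → f (suc g , k′))
    S+c k = +-cancelˡ-≡ P _ _ (begin
      P + (S-cell f (suc g , k) + suc (c k)) ≡⟨ +-comm P _ ⟩
      S-cell f (suc g , k) + suc (c k) + P   ≡⟨ +-assoc (S-cell f (suc g , k)) _ _ ⟩
      S-cell f (suc g , k) + (suc (c k) + P) ≡⟨ cong (S-cell f (suc g , k) +_) (+-comm (suc (c k)) P) ⟩
      S-cell f (suc g , k) + (P + suc (c k)) ≡⟨ cong (S-cell f (suc g , k) +_) (proj₂ (proj₂ (chosen k))) ⟨
      S-cell f (suc g , k) + f (suc g , k)   ≡⟨ S-clique f g k ⟩
      prefix (λ i → f (zero , i)) (toℕ k) + ∑ (λ k′ → f (suc g , k′))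
        ≡⟨ cong (_+ ∑ (λ k′ → f (suc g , k′))) (prefix-cong g-guesses (toℕ k)) ⟨
      P + ∑ (λ k′ → f (suc g , k′)) ∎)
      where
      P : ℕ
      P = base (suc g , k)

  separator : Separator j
  separator = graph , (λ {u} {v} → ones-additive {u} {v}) , lists ,
    (λ v → interval-labelSet {graph} (base (decode size v)) j) , lists-bad

-- The graph G

∑-⊙ : ∀ {n} b (f : Fin n → ℕ) → ∑ (λ i → b ⊙ f i) ≡ b ⊙ ∑ f
∑-⊙     true  f = refl
∑-⊙ {n} false f = ∑-zero n

∑-suc : ∀ {n} (f : Fin n → ℕ) → ∑ (suc ∘ f) ≡ n + ∑ f
∑-suc {zero}  f = refl
∑-suc {suc n} f = cong suc (begin
  f zero + ∑ (suc ∘ f ∘ suc)  ≡⟨ cong (f zero +_) (∑-suc (f ∘ suc)) ⟩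
  f zero + (n + ∑ (f ∘ suc))  ≡⟨ +-assoc (f zero) n _ ⟨
  f zero + n + ∑ (f ∘ suc)    ≡⟨ cong (_+ ∑ (f ∘ suc)) (+-comm (f zero) n) ⟩
  n + f zero + ∑ (f ∘ suc)    ≡⟨ +-assoc n (f zero) _ ⟩
  n + ∑ f                     ∎)
  where open ≡-Reasoning

-- Greedy filling: the first summand takes `c ⊓ e` and leaves `e ∸ c` to the others.
boundedSummands : ∀ s c e → e ≤ s * c → Σ[ f ∈ (Fin s → ℕ) ] (∀ i → f i ≤ c) × ∑ f ≡ e
boundedSummands zero    c zero z≤n = (λ ()) , (λ ()) , refl
boundedSummands (suc s) c e e≤
  with f , f≤c , ∑f ← boundedSummands s c (e ∸ c) (m≤n+o⇒m∸n≤o e c e≤)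
  = (λ { zero → c ⊓ e ; (suc i) → f i })
  , (λ { zero → m⊓n≤m c e ; (suc i) → f≤c i })
  , trans (cong (c ⊓ e +_) ∑f) (m⊓n+n∸m≡n c e)

-- Block zero is H, block suc t is part t.  With labels in [a], part t can get the
-- label sum target t; the targets are m + 1, …, a r.
module Join (H : Graph) (ones-additive : IsAdditive H (const 1)) (a′ q : ℕ) where

  open Graph H using () renaming (_~_ to _~ᴴ_; _~?_ to _~ᴴ?_)

  a m p r K : ℕ
  a = suc a′
  m = order H
  -- The 2 is what `few` needs: it counts 0 among the possible part sums too, which makes (a - 1) r
  -- + 1 values.
  p = suc (suc q)
  r = m + p
  -- This is a r - m, the number of targets m + 1, ..., a r.
  K = p + a′ * r

  -- A part with target at most `r` has its target as size, so ones suffice there. Later parts have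
  -- size `r` and need larger labels.
  target part : Fin K → ℕ
  target t = suc (m + toℕ t)
  part t   = target t ⊓ r

  size : Fin (suc K) → ℕ
  size zero    = m
  size (suc t) = part t

  adj : Cell size → Cell size → Bool
  adj (zero  , u) (zero   , v) = does (u ~ᴴ? v)
  adj (zero  , _) (suc _  , _) = true
  adj (suc _ , _) (zero   , _) = true
  adj (suc t , _) (suc t′ , _) = not (does (t Fin.≟ t′))

  adj-sym : ∀ c d → adj c d ≡ adj d c
  adj-sym (zero  , u) (zero   , v) = does-⇔ (mk⇔ (Graph.~-sym H) (Graph.~-sym H)) (u ~ᴴ? v) (v ~ᴴ? u)
  adj-sym (zero  , _) (suc _  , _) = refl
  adj-sym (suc _ , _) (zero   , _) = refl
  adj-sym (suc t , _) (suc t′ , _) = cong not (does-⇔ (mk⇔ sym sym) (t Fin.≟ t′) (t′ Fin.≟ t))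

  adj-irrefl : ∀ c → adj c c ≡ false
  adj-irrefl (zero  , u) = dec-false (u ~ᴴ? u) (Graph.~-irrefl H refl)
  adj-irrefl (suc t , _) = cong not (dec-true (t Fin.≟ t) refl)

  open BlockGraph size adj adj-sym adj-irrefl public

  0<part : ∀ t → 0 < part t
  0<part t = ⊓-glb (s≤s z≤n) (≤-trans (s≤s z≤n) (m≤n+m p m))

  vertex : Fin K → Cell size
  vertex t = suc t , fromℕ< (0<part t)

  core-sum parts-sum : (Cell size → ℕ) → ℕ
  core-sum f  = ∑ λ u → f (zero , u)
  parts-sum f = ∑ λ t → ∑ λ i → f (suc t , i)

  part-sum : (Cell size → ℕ) → Fin K → ℕ
  part-sum f t = ∑ λ i → f (suc t , i)

  -- The join adds one and the same amount to all sums in `H`, so it keeps both equalities and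
  -- inequalities between them.
  S-core : ∀ f u → S-cell f (zero , u) ≡ S H (λ v → f (zero , v)) u + parts-sum f
  S-core f u = cong (_+ parts-sum f) (sym (S-∑ H (λ v → f (zero , v)) u))

  S-part : ∀ f t i → S-cell f (suc t , i) + part-sum f t ≡ core-sum f + parts-sum f
  S-part f t i = begin
    core-sum f + ∑ (λ t′ → ∑ λ i′ → not (does (t Fin.≟ t′)) ⊙ f (suc t′ , i′)) + part-sum f t
      ≡⟨ cong (λ s → core-sum f + s + part-sum f t)
           (∑-cong λ t′ → ∑-⊙ (not (does (t Fin.≟ t′))) (λ i′ → f (suc t′ , i′))) ⟩
    core-sum f + ∑ (λ t′ → not (does (t Fin.≟ t′)) ⊙ part-sum f t′) + part-sum f t
      ≡⟨ +-assoc (core-sum f) _ _ ⟩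
    core-sum f + (∑ (λ t′ → not (does (t Fin.≟ t′)) ⊙ part-sum f t′) + part-sum f t)
      ≡⟨ cong (core-sum f +_) (∑-others (part-sum f) t) ⟩
    core-sum f + parts-sum f ∎
    where open ≡-Reasoning

  part-sum-distinct : ∀ {ℓ} → IsAdditive graph ℓ → ∀ {t t′} → t ≢ t′ →
                      part-sum (ℓ ∘ encode size) t ≢ part-sum (ℓ ∘ encode size) t′
  part-sum-distinct {ℓ} additive {t} {t′} t≢t′ eq =
    additive (adj⇒~ {vertex t} {vertex t′} (cong not (dec-false (t Fin.≟ t′) t≢t′))) (begin
      S graph ℓ (encode size (vertex t))  ≡⟨ S-graph ℓ (vertex t) ⟩
      S-cell f (vertex t)                 ≡⟨ +-cancelʳ-≡ (part-sum f t) _ _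
        (trans (S-part f t (proj₂ (vertex t)))
          (sym (trans (cong (S-cell f (vertex t′) +_) eq) (S-part f t′ (proj₂ (vertex t′)))))) ⟩
      S-cell f (vertex t′)                ≡⟨ S-graph ℓ (vertex t′) ⟨
      S graph ℓ (encode size (vertex t′)) ∎)
    where
    open ≡-Reasoning
    f : Cell size → ℕ
    f = ℓ ∘ encode size

  -- The capacity of a part under labels up to `a` is `a` times its size. It is enough for parts of
  -- size `r` because no target exceeds a r.
  target≤ : ∀ t → target t ≤ part t + part t * a′
  target≤ t with ≤-total (target t) r
  ... | inj₁ target≤r rewrite m≤n⇒m⊓n≡m target≤r = m≤m+n _ _
  ... | inj₂ r≤target rewrite m≥n⇒m⊓n≡n r≤target = begin
    suc (m + toℕ t)    ≡⟨ +-suc m (toℕ t) ⟨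
    m + suc (toℕ t)    ≤⟨ +-monoʳ-≤ m (toℕ<n t) ⟩
    m + (p + a′ * r)   ≡⟨ +-assoc m p _ ⟨
    r + a′ * r         ≡⟨ cong (r +_) (*-comm a′ r) ⟩
    r + r * a′         ∎
    where open ≤-Reasoning

  -- Each label is 1 plus an excess of at most a - 1; the excesses make up the difference between
  -- target and size.
  excess : ∀ t → Σ[ f ∈ (Fin (part t) → ℕ) ] (∀ i → f i ≤ a′) × ∑ f ≡ target t ∸ part t
  excess t = boundedSummands (part t) a′ (target t ∸ part t)
               (m≤n+o⇒m∸n≤o (target t) (part t) (target≤ t))

  labels : Cell size → ℕ
  labels (zero  , u) = 1
  labels (suc t , i) = suc (proj₁ (excess t) i)

  labels-bounded : ∀ c → 1 ≤ labels c × labels c ≤ a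
  labels-bounded (zero  , u) = s≤s z≤n , s≤s z≤n
  labels-bounded (suc t , i) = s≤s z≤n , s≤s (proj₁ (proj₂ (excess t)) i)

  part-sum-labels : ∀ t → part-sum labels t ≡ target t
  part-sum-labels t = trans (∑-suc (proj₁ (excess t)))
    (trans (cong (part t +_) (proj₂ (proj₂ (excess t)))) (m+[n∸m]≡n (m⊓n≤m (target t) r)))

  S-part-labels : ∀ t i → S-cell labels (suc t , i) + target t ≡ m + parts-sum labels
  S-part-labels t i = begin
    S-cell labels (suc t , i) + target t          ≡⟨ cong (S-cell labels (suc t , i) +_) (part-sum-labels t) ⟨
    S-cell labels (suc t , i) + part-sum labels t ≡⟨ S-part labels t i ⟩
    core-sum labels + parts-sum labels            ≡⟨ cong (_+ parts-sum labels) (∑-one m) ⟩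
    m + parts-sum labels                          ∎
    where open ≡-Reasoning

  -- A vertex of `H` sees all parts, so its sum is at least `P`. A vertex of part `t` has sum m + P
  -- - `target t`, which is below `P` because the targets start at m + 1.
  core≢part : ∀ u t i → S-cell labels (zero , u) ≢ S-cell labels (suc t , i)
  core≢part u t i eq = m+1+n≰m m (+-cancelʳ-≤ (parts-sum labels) _ _ (begin
    m + suc (toℕ t) + P                  ≡⟨ cong (_+ P) (+-suc m (toℕ t)) ⟩
    target t + P                         ≡⟨ +-comm (target t) P ⟩
    P + target t                         ≤⟨ +-monoˡ-≤ (target t) (m≤n+m P (S H (const 1) u)) ⟩
    S H (const 1) u + P + target t       ≡⟨ cong (_+ target t) (trans (sym (S-core labels u)) eq) ⟩
    S-cell labels (suc t , i) + target t ≡⟨ S-part-labels t i ⟩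
    m + P                                ∎))
    where
    open ≤-Reasoning
    P : ℕ
    P = parts-sum labels

  S-labels-distinct : ∀ c d → adj c d ≡ true → S-cell labels c ≢ S-cell labels d
  S-labels-distinct (zero , u) (zero , v) c~d eq with u ~ᴴ? v
  ... | yes u~v = ones-additive u~v (+-cancelʳ-≡ (parts-sum labels) _ _
                    (trans (sym (S-core labels u)) (trans eq (S-core labels v))))
  S-labels-distinct (zero  , u) (suc t , i) c~d eq = core≢part u t i eq
  S-labels-distinct (suc t , i) (zero  , u) c~d eq = core≢part u t i (sym eq)
  S-labels-distinct (suc t , i) (suc t′ , i′) c~d eq with t Fin.≟ t′
  ... | no t≢t′ = t≢t′ (toℕ-injective (+-cancelˡ-≡ (suc m) _ _
    (+-cancelˡ-≡ (S-cell labels (suc t , i)) _ _ (begin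
      S-cell labels (suc t , i) + target t    ≡⟨ S-part-labels t i ⟩
      m + parts-sum labels                    ≡⟨ S-part-labels t′ i′ ⟨
      S-cell labels (suc t′ , i′) + target t′ ≡⟨ cong (_+ target t′) eq ⟨
      S-cell labels (suc t , i) + target t′   ∎))))
    where open ≡-Reasoning

  labelable : AdditivelyLabelable graph a
  labelable = labels ∘ decode size , labels-bounded ∘ decode size , λ {u} {v} u~v eq →
    S-labels-distinct (decode size u) (decode size v) (Equivalence.to T-≡ u~v)
      (trans (sym (S-decode labels u)) (trans eq (S-decode labels v)))

  -- Lower bound for the additive number

  a≤labelable : ∀ k → 1 ≤ k × AdditivelyLabelable graph k → a ≤ k
  a≤labelable k (_ , ℓ , bounds , additive) = ≮⇒≥ λ k<a →
    let bound = part-sum≤ (≤-pred k<a)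
        t , t′ , t<t′ , eq = pigeonhole few (λ t → fromℕ< (s≤s (bound t)))
    in part-sum-distinct additive (Fin.<⇒≢ t<t′)
         (trans (sym (toℕ-fromℕ< (s≤s (bound t)))) (trans (cong toℕ eq) (toℕ-fromℕ< (s≤s (bound t′)))))
    where
    part-sum≤ : k ≤ a′ → ∀ t → part-sum (ℓ ∘ encode size) t ≤ r * a′
    part-sum≤ k≤a′ t = begin
      part-sum (ℓ ∘ encode size) t  ≤⟨ ∑-mono {part t} (λ i → ≤-trans (proj₂ (bounds _)) k≤a′) ⟩
      ∑ {part t} (const a′)         ≡⟨ ∑-const (part t) a′ ⟩
      part t * a′                   ≤⟨ *-monoˡ-≤ a′ (m⊓n≤n (target t) r) ⟩
      r * a′                        ∎
      where open ≤-Reasoning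

    few : suc (r * a′) < K
    few = s≤s (s≤s (≤-trans (≤-reflexive (*-comm r a′)) (m≤n+m _ q)))

  additiveNumber : IsAdditiveNumber graph a
  additiveNumber = (s≤s z≤n , labelable) , a≤labelable

  -- Minimum degree of the join

  degree-cell : ∀ v → Graph.degree graph v ≡ S-cell (const 1) (decode size v)
  degree-cell v = trans (degree-S graph v) (S-decode (const 1) v)

  order-cells : core-sum (const 1) + parts-sum (const 1) ≡ order graph
  order-cells = cong₂ _+_ (∑-one m) (∑-cong (∑-one ∘ part))

  S-part-ones : ∀ t i → S-cell (const 1) (suc t , i) + part t ≡ order graph
  S-part-ones t i = trans
    (cong (S-cell (const 1) (suc t , i) +_) (sym (∑-one (part t))))
    (trans (S-part (const 1) t i) order-cells)

  -- The vertices not adjacent to a given one, itself included, lie in its own block, and every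
  -- block has at most `r` vertices.
  order≤S+r : ∀ c → order graph ≤ S-cell (const 1) c + r
  order≤S+r (zero  , u) = begin
    order graph                                ≡⟨⟩
    m + ∑ part                                 ≤⟨ +-monoˡ-≤ (∑ part) (m≤m+n m p) ⟩
    r + ∑ part                                 ≡⟨ +-comm r _ ⟩
    ∑ part + r                                 ≡⟨ cong (_+ r) (∑-cong λ t → ∑-one (part t)) ⟨
    parts-sum (const 1) + r
      ≤⟨ +-monoˡ-≤ r (m≤n+m (parts-sum (const 1)) (∑ λ v → does (u ~ᴴ? v) ⊙ 1)) ⟩
    S-cell (const 1) (zero , u) + r            ∎
    where open ≤-Reasoning
  order≤S+r (suc t , i) = begin
    order graph                                ≡⟨ S-part-ones t i ⟨
    S-cell (const 1) (suc t , i) + part t      ≤⟨ +-monoʳ-≤ _ (m⊓n≤n (target t) r) ⟩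
    S-cell (const 1) (suc t , i) + r           ∎
    where open ≤-Reasoning

  suc-q<K : suc q < K
  suc-q<K = m≤m+n p (a′ * r)

  -- The part whose target is exactly `r`; its vertices attain the minimum degree.
  full : Fin K
  full = fromℕ< suc-q<K

  part-full : part full ≡ r
  part-full = begin
    suc (m + toℕ full) ⊓ r ≡⟨ cong (λ x → suc (m + x) ⊓ r) (toℕ-fromℕ< suc-q<K) ⟩
    suc (m + suc q) ⊓ r    ≡⟨ cong (_⊓ r) (+-suc m (suc q)) ⟨
    r ⊓ r                  ≡⟨ ⊓-idem r ⟩
    r                      ∎
    where open ≡-Reasoning

  δ : ℕ
  δ = S-cell (const 1) (vertex full)

  order-δ : order graph ≡ δ + r
  order-δ = trans (sym (S-part-ones full (proj₂ (vertex full)))) (cong (δ +_) part-full)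

  minDegree : IsMinDegree graph δ
  minDegree =
    (encode size (vertex full) ,
      trans (degree-cell _) (cong (S-cell (const 1)) (decode-encode size (vertex full)))) ,
    λ { d (v , refl) → +-cancelʳ-≤ r δ _ (begin
          δ + r                                ≡⟨ order-δ ⟨
          order graph                          ≤⟨ order≤S+r (decode size v) ⟩
          S-cell (const 1) (decode size v) + r ≡⟨ cong (_+ r) (degree-cell v) ⟨
          Graph.degree graph v + r             ∎) }
    where open ≤-Reasoning

  -- Bad lists for the join

  module _ {j} (L : Graph.Vertex H → List ℕ) (L-ok : ∀ v → IsLabelSet H j (L v))
           (L-bad : ∀ ℓ → (∀ v → ℓ v ∈ L v) → ∃₂ λ u v → u ~ᴴ v × S H ℓ u ≡ S H ℓ v) where

    -- Every list size `k ≤ j` has to be refuted. Cutting the bad lists of `H` down to `k` entries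
    -- keeps them bad, as a choice from the shorter lists is one from the full lists.
    lists : ℕ → Cell size → List ℕ
    lists k (zero  , u) = take k (L u)
    lists k (suc t , i) = interval 0 k

    lists-ok : ∀ {k} → k ≤ j → ∀ c → IsLabelSet graph k (lists k c)
    lists-ok {k} k≤j (zero  , u) with len , unique , positive ← L-ok u =
      trans (length-take k (L u)) (trans (cong (k ⊓_) len) (m≤n⇒m⊓n≡m k≤j)) ,
      Unique.take⁺ k unique , All.take⁺ k positive
    lists-ok {k} k≤j (suc t , i) = interval-labelSet {graph} 0 k

    ¬listLabelable : ∀ {k} → k ≤ j → ¬ AdditivelyListLabelable graph k
    ¬listLabelable {k} k≤j labelling
      with ℓ , ℓ∈ , additive ← labelling (lists k ∘ decode size) (lists-ok k≤j ∘ decode size)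
      with u , v , u~v , eq ← L-bad (λ u → ℓ (encode size (zero , u))) (λ u →
             subst (_ ∈_) (take++drop≡id k (L u)) (∈-++⁺ˡ
               (subst (λ c → ℓ (encode size (zero , u)) ∈ lists k c)
                 (decode-encode size (zero , u)) (ℓ∈ (encode size (zero , u))))))
      = additive (adj⇒~ {zero , u} {zero , v} (dec-true (u ~ᴴ? v) u~v)) (begin
          S graph ℓ (encode size (zero , u))            ≡⟨ S-graph ℓ (zero , u) ⟩
          S-cell (ℓ ∘ encode size) (zero , u)           ≡⟨ S-core (ℓ ∘ encode size) u ⟩
          S H _ u + parts-sum (ℓ ∘ encode size)         ≡⟨ cong (_+ parts-sum (ℓ ∘ encode size)) eq ⟩
          S H _ v + parts-sum (ℓ ∘ encode size)         ≡⟨ S-core (ℓ ∘ encode size) v ⟨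
          S-cell (ℓ ∘ encode size) (zero , v)           ≡⟨ S-graph ℓ (zero , v) ⟨
          S graph ℓ (encode size (zero , v))            ∎)
      where open ≡-Reasoning

    listAdditiveNumber : ListAdditiveNumberAtLeast graph (suc j)
    listAdditiveNumber = additivelyListLabelable graph ,
      λ k (_ , labelling) → ≰⇒> λ k≤j → ¬listLabelable k≤j labelling

-- The order of G

-- The sizes m + 1, ..., m + p are followed by `N` times m + p; doubling avoids a division. The
-- induction splits off the smallest part and passes from `m` and `suc p` to `suc m` and `p`, which
-- keeps the cap fixed.
∑-truncated : ∀ p N m →
  2 * ∑ {p + N} (λ t → suc (m + toℕ t) ⊓ (m + p)) ≡ 2 * m * p + p * suc p + 2 * (N * (m + p))
∑-truncated zero N m = begin
  2 * ∑ {N} (λ t → suc (m + toℕ t) ⊓ (m + 0))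
    ≡⟨ cong (2 *_) (∑-cong {N} λ t → m≥n⇒m⊓n≡n (≤-trans (+-monoʳ-≤ m z≤n) (n≤1+n _))) ⟩
  2 * ∑ {N} (const (m + 0))     ≡⟨ cong (2 *_) (∑-const N (m + 0)) ⟩
  2 * (N * (m + 0))             ≡⟨ cong (λ x → x + 0 + 2 * (N * (m + 0))) (*-zeroʳ (2 * m)) ⟨
  2 * m * 0 + 0 + 2 * (N * (m + 0)) ∎
  where open ≡-Reasoning
∑-truncated (suc p) N m = begin
  2 * (suc (m + 0) ⊓ (m + suc p) + ∑ {p + N} (λ t → suc (m + suc (toℕ t)) ⊓ (m + suc p)))
    ≡⟨ cong (2 *_) (cong₂ _+_ head
         (∑-cong {p + N} λ t → cong₂ (λ x y → suc x ⊓ y) (+-suc m (toℕ t)) (+-suc m p))) ⟩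
  2 * (suc m + ∑ {p + N} (λ t → suc (suc m + toℕ t) ⊓ (suc m + p)))
    ≡⟨ *-distribˡ-+ 2 (suc m) _ ⟩
  2 * suc m + 2 * ∑ {p + N} (λ t → suc (suc m + toℕ t) ⊓ (suc m + p))
    ≡⟨ cong (λ s → 2 * suc m + s) (∑-truncated p N (suc m)) ⟩
  2 * suc m + (2 * suc m * p + p * suc p + 2 * (N * (suc m + p)))
    ≡⟨ rearrange m p N ⟩
  2 * m * suc p + suc p * suc (suc p) + 2 * (N * (m + suc p)) ∎
  where
  open ≡-Reasoning
  head : suc (m + 0) ⊓ (m + suc p) ≡ suc m
  head = trans (m≤n⇒m⊓n≡m (≤-trans (s≤s (+-monoʳ-≤ m z≤n)) (≤-reflexive (sym (+-suc m p)))))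
               (cong suc (+-identityʳ m))
  rearrange : ∀ m p N → 2 * suc m + (2 * suc m * p + p * suc p + 2 * (N * (suc m + p))) ≡
                        2 * m * suc p + suc p * suc (suc p) + 2 * (N * (m + suc p))
  rearrange = solve-∀

-- Opened only here because the constructor +_ makes sections (x +_) ambiguous.
open import Data.Integer as ℤ using (+_; _-_)
import Data.Integer.Properties as ℤ
import Data.Integer.Tactic.RingSolver as ℤ

-- Comparison with the square root

pos-* : ∀ k z → + k ℤ.* (+ z ℤ.* + z) ≡ + (k * (z * z))
pos-* k z = trans (cong (+ k ℤ.*_) (sym (ℤ.pos-* z z))) (sym (ℤ.pos-* k (z * z)))

≤-√ : ∀ z {p k} → k * (z * z) ≤ p → (+ z) ≤√ p / k
≤-√ z {p} {k} le = inj₂ (subst (ℤ._≤ + p) (sym (pos-* k z)) (ℤ.+≤+ le))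

√-≤ : ∀ z {p k} → p ≤ k * (z * z) → √ p / k ≤ (+ z)
√-≤ z {p} {k} le = ℤ.+≤+ z≤n , subst (+ p ℤ.≤_) (sym (pos-* k z)) (ℤ.+≤+ le)

-- The gap n - δ = C + q, where q ≤ √(p/k) ≤ q + 2 C.
near-√ : ∀ {δ n p} k C q → n ≡ δ + (C + q) →
         k * (q * q) ≤ p → p ≤ k * ((C + (C + q)) * (C + (C + q))) →
         ∣ + δ - + n +√ p / k ∣≤ C
near-√ {δ} {p = p} k C q refl lower upper =
  subst (_≤√ p / k) (sym lower-end) (≤-√ q {k = k} lower) ,
  subst (√ p / k ≤_) (sym upper-end) (√-≤ (C + (C + q)) {k = k} upper)
  where
  gap : + δ - + (δ + (C + q)) ≡ ℤ.- (+ C ℤ.+ + q)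
  gap = trans (cong (λ x → + δ - x) (trans (ℤ.pos-+ δ (C + q)) (cong (λ x → + δ ℤ.+ x) (ℤ.pos-+ C q))))
              (cancel (+ δ) (+ C) (+ q))
    where
    cancel : ∀ d c q → d - (d ℤ.+ (c ℤ.+ q)) ≡ ℤ.- (c ℤ.+ q)
    cancel = ℤ.solve-∀
  lower-end : (ℤ.- + C) - (+ δ - + (δ + (C + q))) ≡ + q
  lower-end = trans (cong (λ x → (ℤ.- + C) - x) gap) (cancel (+ C) (+ q))
    where
    cancel : ∀ c q → (ℤ.- c) - (ℤ.- (c ℤ.+ q)) ≡ q
    cancel = ℤ.solve-∀
  upper-end : + C - (+ δ - + (δ + (C + q))) ≡ + (C + (C + q))
  upper-end = trans (cong (λ x → + C - x) gap) (cancel (+ C) (+ q))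
    where
    cancel : ∀ c q → c - (ℤ.- (c ℤ.+ q)) ≡ c ℤ.+ (c ℤ.+ q)
    cancel = ℤ.solve-∀

-- Both bounds are for twice the order m + ∑ part of the join, as evaluated by ∑-truncated.

order-lower : ∀ a′ m q → let p = suc (suc q) in
  (2 * suc a′ ∸ 1) * (q * q) ≤ 2 * m + (2 * m * p + p * suc p + 2 * (a′ * (m + p) * (m + p)))
order-lower a′ m q = m+n≤o⇒m≤o _ (≤-reflexive (expand a′ m q))
  where
  -- The second summand is the difference of the two sides, a polynomial with nonnegative
  -- coefficients. The factor `a′ + suc (a′ + 0)` is the normal form of `2 * suc a′ ∸ 1`, free of
  -- subtraction for the solver.
  expand : ∀ a′ m q → let p = suc (suc q) in
    (a′ + suc (a′ + 0)) * (q * q) +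
    (2 * m + 2 * m * p + 5 * q + 6 + 2 * a′ * ((m + 2) * (m + 2) + 2 * (m + 2) * q)) ≡
    2 * m + (2 * m * p + p * suc p + 2 * (a′ * (m + p) * (m + p)))
  expand = solve-∀

order-upper : ∀ a′ m q → let p = suc (suc q); c = 2 + m in
  2 * m + (2 * m * p + p * suc p + 2 * (a′ * (m + p) * (m + p))) ≤
  (2 * suc a′ ∸ 1) * ((c + (c + q)) * (c + (c + q)))
order-upper a′ m q = m+n≤o⇒m≤o _ (≤-reflexive (expand a′ m q))
  where
  expand : ∀ a′ m q → let p = suc (suc q); c = 2 + m in
    2 * m + (2 * m * p + p * suc p + 2 * (a′ * (m + p) * (m + p))) +
    (4 * m * m + 10 * m + 10 + 2 * m * q + 3 * q + 2 * a′ * ((m + 2) * (3 * m + 6 + 2 * q))) ≡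
    (a′ + suc (a′ + 0)) * ((c + (c + q)) * (c + (c + q)))
  expand = solve-∀

separator⇒corollary : ∀ a′ {j} → Separator j →
  ∃[ C ] ((n₀ : ℕ) → Σ[ G ∈ Graph ] (n₀ ≤ order G ×
  IsAdditiveNumber G (suc a′) ×
  ListAdditiveNumberAtLeast G (suc j) ×
  ∃[ δ ] (IsMinDegree G δ ×
  (∣ (+ δ - + order G) +√ (2 * order G) / (2 * suc a′ ∸ 1) ∣≤ C))))
-- The parameter `q` is n₀ itself, since the order is δ + (2 + m + q). The constant 2 + m comes from
-- `H` alone.
separator⇒corollary a′ (H , ones-additive , L , L-ok , L-bad) = 2 + order H , λ q →
  let open Join H ones-additive a′ q
      gap : order graph ≡ δ + (2 + m + q)
      gap = trans order-δ (cong (λ s → δ + s) (trans (+-suc m (suc q)) (cong suc (+-suc m q))))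
      twice-order : 2 * order graph ≡ 2 * m + (2 * m * p + p * suc p + 2 * (a′ * r * r))
      twice-order = trans (*-distribˡ-+ 2 m (∑ part)) (cong (λ s → 2 * m + s) (∑-truncated p (a′ * r) m))
  in graph
   , subst (q ≤_) (sym gap) (≤-trans (m≤n+m q (2 + m)) (m≤n+m (2 + m + q) δ))
   , additiveNumber
   , listAdditiveNumber L L-ok L-bad
   , δ , minDegree
   , near-√ (2 * suc a′ ∸ 1) (2 + m) q gap
       (≤-trans (order-lower a′ m q) (≤-reflexive (sym twice-order)))
       (≤-trans (≤-reflexive twice-order) (order-upper a′ m q))

corollary1 : (a b : ℕ) → 1 ≤ a → 2 ≤ b →
    ∃[ C ] ((n₀ : ℕ) → Σ[ G ∈ Graph ] (n₀ ≤ order G ×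
    IsAdditiveNumber G a ×
    ListAdditiveNumberAtLeast G b ×
    ∃[ δ ] (IsMinDegree G δ ×
    (∣ (+ δ - + order G) +√ (2 * order G) / (2 * a ∸ 1) ∣≤ C))))
corollary1 (suc a′) (suc (suc j′)) (s≤s z≤n) (s≤s (s≤s z≤n)) = separator⇒corollary a′ (Gadget.separator j′)
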